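{- Let $\lambda$ be a partition with at most $n$ parts and let $\pi$ be a $\lambda$-permutation. If $\pi$ is $\lambda$-312-avoiding, then the set of Demazure tableaux $\mathcal{D}_\lambda(\pi)$ equals the principal ideal $[Y_\lambda(\pi)] = \{T \in \mathcal{T}_\lambda : T \leq Y_\lambda(\pi)\}$ of $\mathcal{T}_\lambda$.
   Context: Fix $n \geq 1$; write $[m]=\{1,\dots,m\}$ and $(a,b]=\{a+1,\dots,b\}$. A partition is $\lambda=(\lambda_1\ge\cdots\ge\lambda_n\ge 0)\in\mathbb{Z}^n$, $|\lambda|=\sum\lambda_i$. Its shape has boxes $(j,i)$ (column $j$, row $i$) for $1\le j\le\lambda_1$, $1\le i\le\zeta_j$, where $\zeta_j=\#\{i:\lambda_i\ge j\}$. Let $R_\lambda\subseteq[n-1]$ be the set of column lengths $\zeta_j$ that are less than $n$; write $R_\lambda=\{q_1<\cdots<q_r\}$, $q_0=0$, $q_{r+1}=n$; the $h$-th carrel is $(q_{h-1},q_h]$, and $\lambda_i$ is constant on each carrel. A tableau of shape $\lambda$ is a filling $T$ with values $T_j(i)\in[n]$ strictly increasing down columns and weakly increasing along rows; $\mathcal{T}_\lambda$ is the set of these, ordered entrywise. A $\lambda$-permutation is a permutation $\pi=(\pi_1,\dots,\pi_n)$ of $[n]$ that is strictly increasing on each carrel. It is $\lambda$-312-containing if there exist $h\in[r-1]$ and indices $a\le q_h<b\le q_{h+1}<c\le n$ with $\pi_b<\pi_c<\pi_a$, and $\lambda$-312-avoiding otherwise. For $Q\subseteq[n]$, $Y(Q)$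 is the single column containing the elements of $Q$ increasing downward. With $B_h=\{\pi_1,\dots,\pi_{q_h}\}$, the $\lambda$-key $Y_\lambda(\pi)\in\mathcal{T}_\lambda$ has as columns, left to right, $\lambda_n$ copies of $Y([n])$ followed, for $h=r,r-1,\dots,1$ in turn, by $\lambda_{q_h}-\lambda_{q_{h+1}}$ copies of $Y(B_h)$. Scanning tableau $S(T)$ of $T\in\mathcal{T}_\lambda$: the earliest weakly increasing subsequence (EWIS) of a sequence $x_1,x_2,\dots$ is $x_{i_1},x_{i_2},\dots$ with $i_1=1$ and $i_u$ the smallest index $>i_{u-1}$ with $x_{i_u}\ge x_{i_{u-1}}$. To fill column $j$ of $S(T)$: start with the boxes of $T$ in columns $j,\dots,\lambda_1$ unmarked; repeat $\zeta_j$ times: read left to right the values in the lowest unmarked box of each of these columns still having unmarked boxes, form the EWIS of this sequence, mark the boxes contributing to it, and write the last value of the EWIS in the lowest empty box of column $j$ of $S(T)$ (the unmarked boxes always form a partition shape). The Demazure set is $\mathcal{D}_\lambda(\pi)=\{T\in\mathcal{T}_\lambda: S(T)\le Y_\lambda(\pi)\}$. -}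

module Defs where

open import Data.Nat using (ℕ; zero; suc; _+_; _∸_; _≤_; _<_; _≤?_)
open import Data.Nat.Properties using (_≟_)
open import Data.List using (List; []; _∷_; length; filter; applyUpTo; applyDownFrom; map; reverse)
open import Data.List.Membership.DecPropositional _≟_ using (_∈?_)
open import Data.Maybe using (Maybe; just; nothing)
open import Data.Product using (_×_; _,_; Σ; ∃)
open import Relation.Nullary using (¬_; yes; no)

-- Conventions: everything is 1-indexed and uses ℕ-indexed functions.
-- A partition λ with at most n parts is a function λ : ℕ → ℕ of which only the
-- values λ 1, …, λ n are meaningful (parts λ_i ∈ ℕ, so λ_n ≥ 0 automatically).

range1 : ℕ → List ℕ
range1 m = applyUpTo suc m

IsPartition : ℕ → (ℕ → ℕ) → Set
IsPartition n λ' = ∀ i → 1 ≤ i → i < n → λ' (suc i) ≤ λ' i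

ζ : ℕ → (ℕ → ℕ) → ℕ → ℕ
ζ n λ' j = length (filter (λ i → j ≤? λ' i) (range1 n))

-- box (j , i) : column j, row i
InShape : ℕ → (ℕ → ℕ) → ℕ → ℕ → Set
InShape n λ' j i = (1 ≤ j) × (j ≤ λ' 1) × (1 ≤ i) × (i ≤ ζ n λ' j)

-- A filling is a function (column j) (row i) ↦ value; only boxes in the shape matter.
Filling : Set
Filling = ℕ → ℕ → ℕ

IsTableau : ℕ → (ℕ → ℕ) → Filling → Set
IsTableau n λ' T =
  (∀ j i → InShape n λ' j i → (1 ≤ T j i) × (T j i ≤ n)) ×
  (∀ j i → InShape n λ' j i → InShape n λ' j (suc i) → T j i < T j (suc i)) ×
  (∀ j i → InShape n λ' j i → InShape n λ' (suc j) i → T j i ≤ T (suc j) i)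

_≤[_,_]_ : Filling → ℕ → (ℕ → ℕ) → Filling → Set
T ≤[ n , λ' ] U = ∀ j i → InShape n λ' j i → T j i ≤ U j i

IsPerm : ℕ → (ℕ → ℕ) → Set
IsPerm n π =
  (∀ i → 1 ≤ i → i ≤ n → (1 ≤ π i) × (π i ≤ n)) ×
  (∀ i k → 1 ≤ i → i ≤ n → 1 ≤ k → k ≤ n → π i ≡' π k → i ≡' k)
  where
  open import Relation.Binary.PropositionalEquality renaming (_≡_ to _≡'_)

InR : ℕ → (ℕ → ℕ) → ℕ → Set
InR n λ' q = (q < n) × Σ ℕ (λ j → (1 ≤ j) × (j ≤ λ' 1) × (ζ n λ' j ≡' q))
  where
  open import Relation.Binary.PropositionalEquality renaming (_≡_ to _≡'_)

-- a < b lie in the same carrel (q_{h-1}, q_h] iff no q ∈ R_λ satisfies a ≤ q < b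
SameCarrel : ℕ → (ℕ → ℕ) → ℕ → ℕ → Set
SameCarrel n λ' a b = ∀ q → InR n λ' q → a ≤ q → q < b → ⊥'
  where
  open import Data.Empty renaming (⊥ to ⊥')

IsLambdaPerm : ℕ → (ℕ → ℕ) → (ℕ → ℕ) → Set
IsLambdaPerm n λ' π =
  IsPerm n π ×
  (∀ a b → 1 ≤ a → a < b → b ≤ n → SameCarrel n λ' a b → π a < π b)

-- q < q' are consecutive elements q_h < q_{h+1} of R_λ (both in R_λ, so h ∈ [r-1])
Consecutive : ℕ → (ℕ → ℕ) → ℕ → ℕ → Set
Consecutive n λ' q q' = InR n λ' q × InR n λ' q' × (q < q') ×
  (∀ p → InR n λ' p → q < p → p < q' → ⊥')
  where
  open import Data.Empty renaming (⊥ to ⊥')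

Contains312 : ℕ → (ℕ → ℕ) → (ℕ → ℕ) → Set
Contains312 n λ' π =
  Σ ℕ λ q → Σ ℕ λ q' → Σ ℕ λ a → Σ ℕ λ b → Σ ℕ λ c →
    Consecutive n λ' q q' ×
    (1 ≤ a) × (a ≤ q) × (q < b) × (b ≤ q') × (q' < c) × (c ≤ n) ×
    (π b < π c) × (π c < π a)

Avoids312 : ℕ → (ℕ → ℕ) → (ℕ → ℕ) → Set
Avoids312 n λ' π = ¬ Contains312 n λ' π

nth : List ℕ → ℕ → ℕ
nth [] _ = 0
nth (x ∷ xs) zero = x
nth (x ∷ xs) (suc k) = nth xs k

-- Y(Q) for Q = {π_1,…,π_k} ⊆ [n]: the elements of Q increasing downward
Ycol : ℕ → (ℕ → ℕ) → ℕ → List ℕ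
Ycol n π k = filter (λ v → v ∈? map π (range1 k)) (range1 n)

-- λ-key Y_λ(π).  Column j (1 ≤ j ≤ λ_1) of the key is Y(B) where B = {π_1,…,π_{ζ_j}}:
-- the first λ_n columns have length n (B = [n]), and the λ_{q_h} − λ_{q_{h+1}} columns
-- of length q_h carry Y(B_h).  Row i (1-based) is entry i−1.
key : ℕ → (ℕ → ℕ) → (ℕ → ℕ) → Filling
key n λ' π j i = nth (Ycol n π (ζ n λ' j)) (i ∸ 1)

-- Scanning.  The unmarked part of a column is stored bottom-first (head = lowest unmarked box).
-- One EWIS pass over the columns (left to right), given the current last EWIS value;
-- returns the last EWIS value and the columns with contributing boxes marked (removed).
ewisPass : Maybe ℕ → List (List ℕ) → Maybe ℕ × List (List ℕ)
ewisPass cur [] = cur , []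
ewisPass cur ([] ∷ cs) with ewisPass cur cs
... | r , cs' = r , ([] ∷ cs')
ewisPass nothing ((x ∷ xs) ∷ cs) with ewisPass (just x) cs
... | r , cs' = r , (xs ∷ cs')
ewisPass (just v) ((x ∷ xs) ∷ cs) with v ≤? x
... | yes _ with ewisPass (just x) cs
...   | r , cs' = r , (xs ∷ cs')
ewisPass (just v) ((x ∷ xs) ∷ cs) | no _ with ewisPass (just v) cs
...   | r , cs' = r , ((x ∷ xs) ∷ cs')

fromMaybe0 : Maybe ℕ → ℕ
fromMaybe0 nothing = 0
fromMaybe0 (just x) = x

-- k passes; returns the written values in order (bottom box first)
scanPasses : ℕ → List (List ℕ) → List ℕ
scanPasses zero cs = []
scanPasses (suc k) cs with ewisPass nothing cs
... | r , cs' = fromMaybe0 r ∷ scanPasses k cs'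

colBottomFirst : ℕ → (ℕ → ℕ) → Filling → ℕ → List ℕ
colBottomFirst n λ' T c = applyDownFrom (λ k → T c (suc k)) (ζ n λ' c)

colsFrom : ℕ → (ℕ → ℕ) → Filling → ℕ → List (List ℕ)
colsFrom n λ' T j = applyUpTo (λ k → colBottomFirst n λ' T (j + k)) (suc (λ' 1) ∸ j)

-- scanning tableau S(T): column j is filled bottom-up by ζ_j passes;
-- row i (1-based, top = 1) is entry i−1 of the reversed list.
scan : ℕ → (ℕ → ℕ) → Filling → Filling
scan n λ' T j i = nth (reverse (scanPasses (ζ n λ' j) (colsFrom n λ' T j))) (i ∸ 1)

{-# OPTIONS --safe #-}
-- T ≤ S(T) always holds, as every scanning pass starts in the leftmost column.
-- Conversely let T ≤ Y := Y_λ(π), fix a column j, and suppose that the entries of S(T) in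
-- column j strictly below row i are bounded by those of Y.  The entry s of S(T) in box (j,i)
-- is T_k(i') for some k ≥ j and i' ≤ i, so s ≤ c := Y_k(i').  If y := Y_j(i) < s, then the
-- elements of B_j (the j-th column of Y) up to y cannot all lie in B_k, so some b ∈ B_j ∖ B_k
-- satisfies b ≤ y < c ∈ B_k.  312-avoidance puts the whole interval [b,c] into B_j; hence
-- y + 1 is the next entry of Y_j, and the columns of S(T) being strict, s < y + 1.
module Submission where

open import Defs
open import Data.Empty using (⊥; ⊥-elim)
open import Data.List using (List; []; _∷_; [_]; _++_; length; map; filter; reverse; applyUpTo; applyDownFrom)
open import Data.List.Membership.Propositional using (_∈_; _∉_)
open import Data.List.Membership.Propositional.Properties using (∈-map⁺; ∈-map⁻; ∈-filter⁺; ∈-filter⁻; ∈-applyUpTo⁺; ∈-applyUpTo⁻)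
open import Data.List.Membership.Propositional.Properties.WithK using (unique∧set⇒bag)
open import Data.List.Properties using (length-applyUpTo; length-filter; length-map; length-reverse; unfold-reverse; filter-complete)
open import Data.List.Relation.Binary.BagAndSetEquality using (∼bag⇒↭)
open import Data.List.Relation.Binary.Permutation.Propositional.Properties using (↭-length)
open import Data.List.Relation.Unary.All as All using (All; []; _∷_)
open import Data.List.Relation.Unary.AllPairs as AllPairs using (AllPairs; []; _∷_)
import Data.List.Relation.Unary.AllPairs.Properties as AllPairs
open import Data.List.Relation.Unary.Any using (here; there)
open import Data.List.Relation.Unary.Linked as Linked using (Linked; []; [-]; _∷_)
import Data.List.Relation.Unary.Linked.Properties as Linked
open import Data.List.Relation.Unary.Unique.Propositional using (Unique)
open import Data.Maybe using (just)
open import Data.Nat using (ℕ; zero; suc; _+_; _∸_; _≤_; _<_; _>_; z≤n; s≤s; s≤s⁻¹; _≤?_)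
open import Data.Nat.Properties
open import Data.List.Membership.DecPropositional _≟_ using (_∈?_)
open import Data.Product using (_×_; _,_; ∃; ∃₂; proj₁; proj₂)
open import Data.Sum using (_⊎_; inj₁; inj₂)
open import Function using (_∘_)
open import Function.Bundles using (_⇔_; mk⇔)
open import Relation.Binary.PropositionalEquality using (_≡_; refl; sym; trans; cong; cong₂; subst; subst₂)
open import Relation.Nullary using (yes; no; contradiction)
open import Relation.Unary using (Decidable)

-- Entries of increasing and of reversed lists; column lengths

nth∈ : ∀ xs {i} → i < length xs → nth xs i ∈ xs
nth∈ (x ∷ xs) {zero}  _   = here refl
nth∈ (x ∷ xs) {suc i} i<l = there (nth∈ xs (s≤s⁻¹ i<l))

∈⇒nth : ∀ {x xs} → x ∈ xs → ∃ λ i → i < length xs × nth xs i ≡ x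
∈⇒nth (here refl) = 0 , s≤s z≤n , refl
∈⇒nth (there x∈xs) with i , i<l , eq ← ∈⇒nth x∈xs = suc i , s≤s i<l , eq

nth-mono-< : ∀ {xs} → AllPairs _<_ xs → ∀ {i k} → i < k → k < length xs → nth xs i < nth xs k
nth-mono-< (x<xs ∷ _)   {zero}  {suc k} _   k<l = All.lookup x<xs (nth∈ _ (s≤s⁻¹ k<l))
nth-mono-< (_ ∷ sorted) {suc i} {suc k} i<k k<l = nth-mono-< sorted (s≤s⁻¹ i<k) (s≤s⁻¹ k<l)

nth-mono-≤ : ∀ {xs} → AllPairs _<_ xs → ∀ {i k} → i ≤ k → k < length xs → nth xs i ≤ nth xs k
nth-mono-≤ sorted i≤k k<l with m≤n⇒m<n∨m≡n i≤k
... | inj₁ i<k  = <⇒≤ (nth-mono-< sorted i<k k<l)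
... | inj₂ refl = ≤-refl

nth-cancel-< : ∀ {xs} → AllPairs _<_ xs → ∀ {i k} → i < length xs → nth xs i < nth xs k → i < k
nth-cancel-< sorted i<l xᵢ<xₖ = ≰⇒> λ k≤i → <⇒≱ xᵢ<xₖ (nth-mono-≤ sorted k≤i i<l)

-- The entries of `xs` up to index `i` occur in `ys` at strictly increasing positions, so the last
-- of them sits at position `i` or later.
nth-subset-≤ : ∀ {xs ys} → AllPairs _<_ xs → AllPairs _<_ ys → ∀ i → i < length xs →
  (∀ t → t ≤ i → nth xs t ∈ ys) → i < length ys × nth ys i ≤ nth xs i
nth-subset-≤ {xs} {ys} xs↑ ys↑ i i<l xs⊆ys
  with u , u<l , yᵤ≡xᵢ ← ∈⇒nth (xs⊆ys i ≤-refl)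
  = ≤-<-trans i≤u u<l , subst (nth ys i ≤_) yᵤ≡xᵢ (nth-mono-≤ ys↑ i≤u u<l)
  where
  index-bound : ∀ i → i < length xs → (∀ t → t ≤ i → nth xs t ∈ ys) →
    ∀ {u} → nth ys u ≡ nth xs i → i ≤ u
  index-bound zero    _   _     _     = z≤n
  index-bound (suc i) i<l xs⊆ys yᵤ≡xᵢ
    with w , w<l , y≡x ← ∈⇒nth (xs⊆ys i (n≤1+n i))
    = ≤-<-trans (index-bound i (<⇒≤ i<l) (λ t t≤i → xs⊆ys t (m≤n⇒m≤1+n t≤i)) y≡x)
        (nth-cancel-< ys↑ w<l (subst₂ _<_ (sym y≡x) (sym yᵤ≡xᵢ) (nth-mono-< xs↑ (n<1+n i) i<l)))
  i≤u = index-bound i i<l xs⊆ys yᵤ≡xᵢ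

nth-++ˡ : ∀ xs {ys i} → i < length xs → nth (xs ++ ys) i ≡ nth xs i
nth-++ˡ (x ∷ xs) {i = zero}  _   = refl
nth-++ˡ (x ∷ xs) {i = suc i} i<l = nth-++ˡ xs (s≤s⁻¹ i<l)

nth-last : ∀ xs {y} → nth (xs ++ [ y ]) (length xs) ≡ y
nth-last []       = refl
nth-last (x ∷ xs) = nth-last xs

nth-reverse-init : ∀ x xs {i} → i < length xs → nth (reverse (x ∷ xs)) i ≡ nth (reverse xs) i
nth-reverse-init x xs {i} i<l = trans (cong (λ ys → nth ys i) (unfold-reverse x xs))
  (nth-++ˡ (reverse xs) (subst (i <_) (sym (length-reverse xs)) i<l))

nth-reverse-last : ∀ x xs → nth (reverse (x ∷ xs)) (length xs) ≡ x
nth-reverse-last x xs = trans (cong (λ ys → nth ys (length xs)) (unfold-reverse x xs))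
  (subst (λ m → nth (reverse xs ++ [ x ]) m ≡ x) (length-reverse xs) (nth-last (reverse xs)))

nth-reverse-< : ∀ {xs} → Linked _>_ xs → ∀ {i} → suc i < length xs →
  nth (reverse xs) i < nth (reverse xs) (suc i)
nth-reverse-< [-] (s≤s ())
nth-reverse-< {x ∷ y ∷ xs} (x>y ∷ linked) {i} 1+i<l with m≤n⇒m<n∨m≡n (s≤s⁻¹ 1+i<l)
... | inj₂ refl
  rewrite nth-reverse-last x (y ∷ xs) | nth-reverse-init x (y ∷ xs) (n<1+n (length xs))
        | nth-reverse-last y xs = x>y
... | inj₁ 1+i<l′
  rewrite nth-reverse-init x (y ∷ xs) 1+i<l′ | nth-reverse-init x (y ∷ xs) (<⇒≤ 1+i<l′)
  = nth-reverse-< linked 1+i<l′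

-- Passes write a column bottom box first, so the head carries the largest index; after `reverse`
-- the index is the position.
data AllDownFrom (P : ℕ → ℕ → Set) : ℕ → List ℕ → Set where
  []  : AllDownFrom P 0 []
  _∷_ : ∀ {l x xs} → P l x → AllDownFrom P l xs → AllDownFrom P (suc l) (x ∷ xs)

AllDownFrom-length : ∀ {P l xs} → AllDownFrom P l xs → length xs ≡ l
AllDownFrom-length []       = refl
AllDownFrom-length (_ ∷ ps) = cong suc (AllDownFrom-length ps)

AllDownFrom-nth : ∀ {P l xs} → AllDownFrom P l xs → ∀ {i} → i < l → P i (nth (reverse xs) i)
AllDownFrom-nth {P} {xs = x ∷ xs} (p ∷ ps) {i} i<l with AllDownFrom-length ps | m≤n⇒m<n∨m≡n (s≤s⁻¹ i<l)
... | refl | inj₁ i<l′ = subst (P i) (sym (nth-reverse-init x xs i<l′)) (AllDownFrom-nth ps i<l′)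
... | refl | inj₂ refl = subst (P i) (sym (nth-reverse-last x xs)) p

length-filter-mono : ∀ {P Q : ℕ → Set} (P? : Decidable P) (Q? : Decidable Q) → (∀ {x} → P x → Q x) →
  ∀ xs → length (filter P? xs) ≤ length (filter Q? xs)
length-filter-mono P? Q? P⇒Q []       = z≤n
length-filter-mono P? Q? P⇒Q (x ∷ xs) with ih ← length-filter-mono P? Q? P⇒Q xs with P? x | Q? x
... | yes _ | yes _  = s≤s ih
... | yes p | no  ¬q = contradiction (P⇒Q p) ¬q
... | no  _ | yes _  = m≤n⇒m≤1+n ih
... | no  _ | no  _  = ih

ζ-antitone : ∀ n λ' {j k} → j ≤ k → ζ n λ' k ≤ ζ n λ' j
ζ-antitone n λ' {j} {k} j≤k =
  length-filter-mono (λ i → k ≤? λ' i) (λ i → j ≤? λ' i) (≤-trans j≤k) (range1 n)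

ζ≤n : ∀ n λ' j → ζ n λ' j ≤ n
ζ≤n n λ' j = subst (ζ n λ' j ≤_) (length-applyUpTo suc n) (length-filter (λ i → j ≤? λ' i) (range1 n))

-- Scanning

-- Two successive passes compared column by column: the second stays strictly below the first.
ewisPass-descends : ∀ {v w} cs → All (Linked _>_) cs → w < v →
  fromMaybe0 (proj₁ (ewisPass (just w) (proj₂ (ewisPass (just v) cs)))) <
  fromMaybe0 (proj₁ (ewisPass (just v) cs))
ewisPass-descends [] _ w<v = w<v
ewisPass-descends ([] ∷ cs) (_ ∷ dec) w<v = ewisPass-descends cs dec w<v
-- The invariant `w < v` survives every column: a box marked by the first pass raises `v` to `x` and
-- exposes at most an entry `y < x`; a skipped box has `x < v`, so the second pass may mark it.
ewisPass-descends {v} {w} ((x ∷ xs) ∷ cs) (_ ∷ dec) w<v with v ≤? x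
ewisPass-descends {v} {w} ((x ∷ [])     ∷ cs) (_ ∷ dec) w<v | yes v≤x =
  ewisPass-descends cs dec (<-≤-trans w<v v≤x)
ewisPass-descends {v} {w} ((x ∷ y ∷ xs) ∷ cs) ((x>y ∷ _) ∷ dec) w<v | yes v≤x with w ≤? y
... | yes _ = ewisPass-descends cs dec x>y
... | no  _ = ewisPass-descends cs dec (<-≤-trans w<v v≤x)
ewisPass-descends {v} {w} ((x ∷ xs) ∷ cs) (_ ∷ dec) w<v | no v≰x with w ≤? x
... | yes _ = ewisPass-descends cs dec (≰⇒> v≰x)
... | no  _ = ewisPass-descends cs dec w<v

module Scanning (n : ℕ) (λ' : ℕ → ℕ) (T : Filling) (tableau : IsTableau n λ' T)
                (j : ℕ) (1≤j : 1 ≤ j) where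

  -- The unmarked boxes: the top l boxes of column k for the successive lengths l in the list.
  cols : ℕ → List ℕ → List (List ℕ)
  cols k []       = []
  cols k (l ∷ ls) = applyDownFrom (λ r → T k (suc r)) l ∷ cols (suc k) ls

  -- The invariant of the passes: the unmarked boxes form a partition shape inside that of λ. The
  -- index `l` is the length of the column to the left of column `k`; the other bounds make the
  -- tableau conditions applicable.
  data Shape : ℕ → ℕ → List ℕ → Set where
    []   : ∀ {l k} → Shape l k []
    cons : ∀ {l k m ls} → m ≤ l → k ≤ λ' 1 → m ≤ ζ n λ' k → Shape m (suc k) ls → Shape l k (m ∷ ls)

  -- Since unmarked columns weakly shorten to the right, a pass started in row `i` never goes below
  -- that row; `r` counts rows from 0.
  Source : ℕ → ℕ → Set
  Source i v = ∃₂ λ k r → j ≤ k × k ≤ λ' 1 × r < i × r < ζ n λ' k × v ≡ T k (suc r)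

  cols-decreasing : ∀ {l k ls} → j ≤ k → Shape l k ls → All (Linked _>_) (cols k ls)
  cols-decreasing j≤k [] = []
  cols-decreasing {k = k} j≤k (cons {m = m} _ k≤ m≤ζ shape) =
    Linked.applyDownFrom⁺₁ (λ r → T k (suc r)) m
      (λ {i} 1+i<m → proj₁ (proj₂ tableau) k (suc i)
        (≤-trans 1≤j j≤k , k≤ , s≤s z≤n , ≤-trans (<⇒≤ 1+i<m) m≤ζ)
        (≤-trans 1≤j j≤k , k≤ , s≤s z≤n , ≤-trans 1+i<m m≤ζ))
    ∷ cols-decreasing (m≤n⇒m≤1+n j≤k) shape

  -- The column left of column k has l unmarked boxes before and l⁻ after the pass; if its lowest
  -- one got marked, then its entry is v, so that a box in the same row of column k is marked too.
  ewisPass-cols : ∀ {i l l⁻ k v ls} → l ≤ i → j ≤ k → Shape l k ls →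
    l ≡ l⁻ ⊎ (l ≡ suc l⁻ × (k ≤ λ' 1 → l ≤ ζ n λ' k → v ≤ T k l)) → Source i v →
    ∃₂ λ r ls' → ewisPass (just v) (cols k ls) ≡ (just r , cols k ls') ×
                 v ≤ r × Source i r × Shape l⁻ k ls'
  ewisPass-cols _ _ [] _ src = _ , [] , refl , ≤-refl , src , []
  ewisPass-cols {k = k} l≤i j≤k (cons {m = zero} _ k≤ _ shape) _ src
    with r , ls' , eq , v≤r , src′ , shape′
           ← ewisPass-cols z≤n (m≤n⇒m≤1+n j≤k) shape (inj₁ refl) src
    rewrite eq
    = r , 0 ∷ ls' , refl , v≤r , src′ , cons z≤n k≤ z≤n shape′
  ewisPass-cols {l⁻ = l⁻} {k} {v} l≤i j≤k (cons {m = suc m} m≤l k≤ m≤ζ shape) prev src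
    with v ≤? T k (suc m)
  ... | yes v≤x
    with r , ls' , eq , x≤r , src′ , shape′
           ← ewisPass-cols (≤-trans m≤l l≤i) (m≤n⇒m≤1+n j≤k) shape
               (inj₂ (refl , λ k<λ₁ m≤ζ′ → proj₂ (proj₂ tableau) k (suc m)
                 (≤-trans 1≤j j≤k , k≤ , s≤s z≤n , m≤ζ) (s≤s z≤n , k<λ₁ , s≤s z≤n , m≤ζ′)))
               (k , m , j≤k , k≤ , ≤-trans m≤l l≤i , m≤ζ , refl)
    rewrite eq
    = r , m ∷ ls' , refl , ≤-trans v≤x x≤r , src′ , cons (m≤l⁻ prev) k≤ (<⇒≤ m≤ζ) shape′
    where
    m≤l⁻ : _ → m ≤ l⁻
    m≤l⁻ (inj₁ refl)       = <⇒≤ m≤l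
    m≤l⁻ (inj₂ (refl , _)) = s≤s⁻¹ m≤l
  ewisPass-cols {l⁻ = l⁻} {k} {v} l≤i j≤k (cons {m = suc m} m≤l k≤ m≤ζ shape) prev src | no v≰x
    with r , ls' , eq , v≤r , src′ , shape′
           ← ewisPass-cols (≤-trans m≤l l≤i) (m≤n⇒m≤1+n j≤k) shape (inj₁ refl) src
    rewrite eq
    = r , suc m ∷ ls' , refl , v≤r , src′ , cons (m<l⁻ prev) k≤ m≤ζ shape′
    where
    m<l⁻ : _ → m < l⁻
    m<l⁻ (inj₁ refl) = m≤l
    m<l⁻ (inj₂ (refl , v≤)) with m≤n⇒m<n∨m≡n m≤l
    ... | inj₁ m<l  = s≤s⁻¹ m<l
    ... | inj₂ refl = contradiction (v≤ k≤ m≤ζ) v≰x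

  -- The lower bound puts the Demazure set inside the ideal; the source serves the converse
  -- inclusion.
  ScanEntry : ℕ → ℕ → Set
  ScanEntry i x = T j (suc i) ≤ x × Source (suc i) x

  -- Column `j` is leftmost, so each pass starts by marking its lowest unmarked box: the starting
  -- boxes climb column `j` one row at a time.
  scanPasses-cols : ∀ l {ls} → j ≤ λ' 1 → l ≤ ζ n λ' j → Shape l (suc j) ls →
    AllDownFrom ScanEntry l (scanPasses l (cols j (l ∷ ls))) ×
    Linked _>_ (scanPasses l (cols j (l ∷ ls)))
  scanPasses-cols zero _ _ _ = [] , []
  scanPasses-cols (suc l) {ls} j≤ l<ζ shape
    with r , ls' , eq , v≤r , src , shape′
           ← ewisPass-cols ≤-refl (n≤1+n j) shape
               (inj₂ (refl , λ j<λ₁ l<ζ′ → proj₂ (proj₂ tableau) j (suc l)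
                 (1≤j , j≤ , s≤s z≤n , l<ζ) (s≤s z≤n , j<λ₁ , s≤s z≤n , l<ζ′)))
               (j , l , ≤-refl , j≤ , ≤-refl , l<ζ , refl)
    with ps , linked ← scanPasses-cols l j≤ (<⇒≤ l<ζ) shape′
    rewrite eq
    = (v≤r , src) ∷ ps , link l l<ζ eq linked
    where
    link : ∀ l {r ls'} → l < ζ n λ' j →
      ewisPass (just (T j (suc l))) (cols (suc j) ls) ≡ (just r , cols (suc j) ls') →
      Linked _>_ (scanPasses l (cols j (l ∷ ls'))) →
      Linked _>_ (r ∷ scanPasses l (cols j (l ∷ ls')))
    link zero    _   _  _      = [-]
    -- The two passes start in adjacent boxes of column `j`, the later one in the upper, smaller
    -- box; `eq` identifies the columns that the first pass leaves to the second.
    link (suc l) l<ζ eq linked =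
      subst (λ p → fromMaybe0 (proj₁ (ewisPass (just (T j (suc l))) (proj₂ p))) < fromMaybe0 (proj₁ p)) eq
        (ewisPass-descends (cols (suc j) ls) (cols-decreasing (n≤1+n j) shape)
          (proj₁ (proj₂ tableau) j (suc l)
            (1≤j , j≤ , s≤s z≤n , <⇒≤ l<ζ) (1≤j , j≤ , s≤s z≤n , l<ζ)))
      ∷ linked

  lengths : ℕ → ℕ → List ℕ
  lengths k zero    = []
  lengths k (suc m) = ζ n λ' k ∷ lengths (suc k) m

  lengths-shape : ∀ {l} k m → k + m ≤ suc (λ' 1) → ζ n λ' k ≤ l → Shape l k (lengths k m)
  lengths-shape k zero    _      _   = []
  lengths-shape k (suc m) k+m≤λ₁ ζ≤l =
    cons ζ≤l (≤-trans (m≤m+n k m) (s≤s⁻¹ k+m<)) ≤-refl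
      (lengths-shape (suc k) m k+m< (ζ-antitone n λ' (n≤1+n k)))
    where
    k+m< : suc (k + m) ≤ suc (λ' 1)
    k+m< = subst (_≤ suc (λ' 1)) (+-suc k m) k+m≤λ₁

  -- `applyUpTo` recurses on its function composed with `suc`, so the column index is a function `g`
  -- known only pointwise.
  applyUpTo-cols : ∀ k m (g : ℕ → ℕ) → (∀ i → g i ≡ k + i) →
    applyUpTo (λ i → colBottomFirst n λ' T (g i)) m ≡ cols k (lengths k m)
  applyUpTo-cols k zero    g g≡ = refl
  applyUpTo-cols k (suc m) g g≡ = cong₂ _∷_
    (cong (colBottomFirst n λ' T) (trans (g≡ 0) (+-identityʳ k)))
    (applyUpTo-cols (suc k) m (g ∘ suc) (λ i → trans (g≡ (suc i)) (+-suc k i)))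

  module _ (j≤ : j ≤ λ' 1) where

    scanned : AllDownFrom ScanEntry (ζ n λ' j) (scanPasses (ζ n λ' j) (colsFrom n λ' T j)) ×
              Linked _>_ (scanPasses (ζ n λ' j) (colsFrom n λ' T j))
    -- By `j≤` the number of columns is a successor, which exposes column `j` as the first.
    scanned rewrite applyUpTo-cols j (suc (λ' 1) ∸ j) (j +_) (λ _ → refl) | +-∸-assoc 1 j≤
      = scanPasses-cols (ζ n λ' j) j≤ ≤-refl
          (lengths-shape (suc j) (λ' 1 ∸ j) (≤-reflexive (cong suc (m+[n∸m]≡n j≤)))
            (ζ-antitone n λ' (n≤1+n j)))

    scan-entry : ∀ {i} → i < ζ n λ' j → ScanEntry i (scan n λ' T j (suc i))
    scan-entry = AllDownFrom-nth (proj₁ scanned)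

    scan-strict : ∀ {i} → suc i < ζ n λ' j → scan n λ' T j (suc i) < scan n λ' T j (suc (suc i))
    scan-strict {i} 1+i<ζ = nth-reverse-< (proj₂ scanned)
      (subst (suc i <_) (sym (AllDownFrom-length (proj₁ scanned))) 1+i<ζ)

-- Keys

Ycol-sorted : ∀ n π k → AllPairs _<_ (Ycol n π k)
Ycol-sorted n π k = AllPairs.filter⁺ (λ v → v ∈? map π (range1 k))
  (AllPairs.applyUpTo⁺₁ suc n (λ i<j _ → s≤s i<j))

∈-range1⁺ : ∀ {v m} → 1 ≤ v → v ≤ m → v ∈ range1 m
∈-range1⁺ {suc v} _ v<m = ∈-applyUpTo⁺ suc v<m

∈-range1⁻ : ∀ {v m} → v ∈ range1 m → 1 ≤ v × v ≤ m
∈-range1⁻ v∈ with i , i<m , refl ← ∈-applyUpTo⁻ suc v∈ = s≤s z≤n , i<m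

module Keys (n : ℕ) (π : ℕ → ℕ) (perm : IsPerm n π) where

  ∈-Ycol⁺ : ∀ {a k} → 1 ≤ a → a ≤ k → k ≤ n → π a ∈ Ycol n π k
  ∈-Ycol⁺ {a} {k} 1≤a a≤k k≤n with 1≤πa , πa≤n ← proj₁ perm a 1≤a (≤-trans a≤k k≤n) =
    ∈-filter⁺ (λ v → v ∈? map π (range1 k)) (∈-range1⁺ 1≤πa πa≤n) (∈-map⁺ π (∈-range1⁺ 1≤a a≤k))

  ∈-Ycol⁻ : ∀ {v k} → v ∈ Ycol n π k → v ≤ n × ∃ λ a → 1 ≤ a × a ≤ k × v ≡ π a
  ∈-Ycol⁻ {k = k} v∈
    with v∈range , v∈B ← ∈-filter⁻ (λ v → v ∈? map π (range1 k)) {xs = range1 n} v∈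
    with a , a∈ , v≡πa ← ∈-map⁻ π v∈B
    with 1≤a , a≤k ← ∈-range1⁻ a∈ = proj₂ (∈-range1⁻ {m = n} v∈range) , a , 1≤a , a≤k , v≡πa

  -- The column and the image list of π have the same elements, both without repetition (for the
  -- image by injectivity of π), hence are permutations of each other.
  length-Ycol : ∀ {k} → k ≤ n → length (Ycol n π k) ≡ k
  length-Ycol {k} k≤n = trans
    (↭-length (∼bag⇒↭ (unique∧set⇒bag (AllPairs.map <⇒≢ (Ycol-sorted n π k)) image-unique
      (mk⇔ (proj₂ ∘ ∈-filter⁻ (λ v → v ∈? map π (range1 k)) {xs = range1 n}) image⊆))))
    (trans (length-map π (range1 k)) (length-applyUpTo suc k))
    where
    image-unique : Unique (map π (range1 k))
    image-unique = AllPairs.map⁺ (AllPairs.applyUpTo⁺₁ suc k λ {a} {b} a<b b<k πa≡πb →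
      <⇒≢ (s≤s a<b) (proj₂ perm (suc a) (suc b) (s≤s z≤n) (≤-trans (≤-trans a<b (<⇒≤ b<k)) k≤n)
        (s≤s z≤n) (≤-trans b<k k≤n) πa≡πb))
    image⊆ : ∀ {v} → v ∈ map π (range1 k) → v ∈ Ycol n π k
    image⊆ v∈ with a , a∈ , refl ← ∈-map⁻ π v∈ with 1≤a , a≤k ← ∈-range1⁻ a∈ = ∈-Ycol⁺ 1≤a a≤k k≤n

  -- For `k = n` the filter defining `Ycol` keeps `n` of `n` values, so it drops nothing.
  π-surjective : ∀ {c} → 1 ≤ c → c ≤ n → ∃ λ a → 1 ≤ a × a ≤ n × c ≡ π a
  π-surjective {c} 1≤c c≤n = proj₂ (∈-Ycol⁻ {k = n} (subst (c ∈_) (sym all) (∈-range1⁺ 1≤c c≤n)))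
    where
    all : Ycol n π n ≡ range1 n
    all = filter-complete (λ v → v ∈? map π (range1 n))
      (trans (length-Ycol ≤-refl) (sym (length-applyUpTo suc n)))

  module _ (λ' : ℕ → ℕ) (avoids : Avoids312 n λ' π) where

    -- A discrete intermediate value argument, walking right from column `j`. Adjacent columns are
    -- sought because no column length lies strictly between theirs.
    crossing : ∀ d {j k β} → j + d ≡ k → β ≤ ζ n λ' j → ζ n λ' k < β →
      ∃ λ m → j ≤ m × m < k × β ≤ ζ n λ' m × ζ n λ' (suc m) < β
    crossing zero {j} refl β≤ζⱼ ζₖ<β rewrite +-identityʳ j = contradiction β≤ζⱼ (<⇒≱ ζₖ<β)
    crossing (suc d) {j} {k} {β} refl β≤ζⱼ ζₖ<β with β ≤? ζ n λ' (suc j)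
    ... | no  β≰ζ = j , ≤-refl , m<m+n j (s≤s z≤n) , β≤ζⱼ , ≰⇒> β≰ζ
    ... | yes β≤ζ with m , j<m , rest ← crossing d (sym (+-suc j d)) β≤ζ ζₖ<β = m , <⇒≤ j<m , rest

    -- The hypothesis concerns consecutive elements of R_λ only; the index β of b selects the
    -- consecutive pair ζ_{m+1} < β ≤ ζ_m between ζ_k and ζ_j to which it is applied.
    Ycol-gapless : ∀ {j k a b c} → 1 ≤ j → j ≤ k → k ≤ λ' 1 →
      b ∈ Ycol n π (ζ n λ' j) → b ∉ Ycol n π (ζ n λ' k) → a ∈ Ycol n π (ζ n λ' k) →
      b < c → c ≤ a → c ∈ Ycol n π (ζ n λ' j)
    Ycol-gapless {j} {k} {a} {b} {c} 1≤j j≤k k≤λ₁ b∈ b∉ a∈ b<c c≤a with c ∈? Ycol n π (ζ n λ' j)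
    ... | yes c∈ = c∈
    ... | no  c∉
      with a≤n , α , 1≤α , α≤ζₖ , refl ← ∈-Ycol⁻ {k = ζ n λ' k} a∈
         | _ , β , 1≤β , β≤ζⱼ , refl ← ∈-Ycol⁻ {k = ζ n λ' j} b∈
      with γ , 1≤γ , γ≤n , refl ← π-surjective (≤-trans (s≤s z≤n) b<c) (≤-trans c≤a a≤n)
      with m , j≤m , m<k , β≤ζₘ , ζ<β ← crossing (k ∸ j) (m+[n∸m]≡n j≤k) β≤ζⱼ
                                          (≰⇒> λ β≤ζₖ → b∉ (∈-Ycol⁺ 1≤β β≤ζₖ (ζ≤n n λ' k)))
      -- If `c` is missing from column `j`, its index γ exceeds ζ_j and thus ζ_m. The values `a`,
      -- `b`, `c` then stand at α ≤ ζ_{m+1} < β ≤ ζ_m < γ, a forbidden pattern; γ ≤ n also places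
      -- both lengths in R_λ.
      = ⊥-elim (avoids (ζ n λ' (suc m) , ζ n λ' m , α , β , γ ,
          ( (<-trans q<q' q'<n , suc m , s≤s z≤n , ≤-trans m<k k≤λ₁ , refl)
          , (q'<n , m , ≤-trans 1≤j j≤m , ≤-trans (<⇒≤ m<k) k≤λ₁ , refl)
          , q<q' , nothing-between)
          , 1≤α , ≤-trans α≤ζₖ (ζ-antitone n λ' m<k) , ζ<β , β≤ζₘ , q'<γ , γ≤n , b<c
          , ≤∧≢⇒< c≤a λ c≡a → c∉ (subst (_∈ Ycol n π (ζ n λ' j)) (sym c≡a)
              (∈-Ycol⁺ 1≤α (≤-trans α≤ζₖ (ζ-antitone n λ' j≤k)) (ζ≤n n λ' j)))))
      where
      q<q' = <-≤-trans ζ<β β≤ζₘ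
      q'<γ = ≤-<-trans (ζ-antitone n λ' j≤m) (≰⇒> λ γ≤ζⱼ → c∉ (∈-Ycol⁺ 1≤γ γ≤ζⱼ (ζ≤n n λ' j)))
      q'<n = <-≤-trans q'<γ γ≤n
      nothing-between : ∀ p → InR n λ' p → ζ n λ' (suc m) < p → p < ζ n λ' m → ⊥
      nothing-between _ (_ , t , _ , _ , refl) q<p p<q' with t ≤? m
      ... | yes t≤m = <⇒≱ p<q' (ζ-antitone n λ' t≤m)
      ... | no  t≰m = <⇒≱ q<p (ζ-antitone n λ' (≰⇒> t≰m))

    -- Gaplessness is tested on the single value `y + 1`, where `y` is the entry of column `j`. Were
    -- it absent, every entry of column `j` up to `y` would lie in column `k`, and `nth-subset-≤`
    -- would contradict `y < c`.
    key-next : ∀ {j k i i'} → 1 ≤ j → j ≤ k → k ≤ λ' 1 →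
      i < ζ n λ' j → i' < ζ n λ' k → i' ≤ i → key n λ' π j (suc i) < key n λ' π k (suc i') →
      suc i < ζ n λ' j × key n λ' π j (suc (suc i)) ≤ suc (key n λ' π j (suc i))
    key-next {j} {k} {i} {i'} 1≤j j≤k k≤λ₁ i<ζ i'<ζ i'≤i y<c
      with suc (nth (Ycol n π (ζ n λ' j)) i) ∈? Ycol n π (ζ n λ' j)
    ... | yes 1+y∈ with u , u<l , eq ← ∈⇒nth 1+y∈ =
      subst (suc i <_) len-j (≤-<-trans i<u u<l) ,
      subst (nth (Ycol n π (ζ n λ' j)) (suc i) ≤_) eq (nth-mono-≤ Yⱼ↑ i<u u<l)
      where
      len-j = length-Ycol (ζ≤n n λ' j)
      Yⱼ↑ = Ycol-sorted n π (ζ n λ' j)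
      i<u = nth-cancel-< Yⱼ↑ (subst (i <_) (sym len-j) i<ζ) (≤-reflexive (sym eq))
    ... | no 1+y∉ = ⊥-elim (<⇒≱ y<c (≤-trans (nth-mono-≤ Yₖ↑ i'≤i (proj₁ below)) (proj₂ below)))
      where
      Yⱼ = Ycol n π (ζ n λ' j)
      Yₖ = Ycol n π (ζ n λ' k)
      Yⱼ↑ = Ycol-sorted n π (ζ n λ' j)
      Yₖ↑ = Ycol-sorted n π (ζ n λ' k)
      i<l : i < length Yⱼ
      i<l = subst (i <_) (sym (length-Ycol (ζ≤n n λ' j))) i<ζ
      i'<l : i' < length Yₖ
      i'<l = subst (i' <_) (sym (length-Ycol (ζ≤n n λ' k))) i'<ζ
      Yⱼ⊆Yₖ : ∀ t → t ≤ i → nth Yⱼ t ∈ Yₖ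
      Yⱼ⊆Yₖ t t≤i with nth Yⱼ t ∈? Yₖ
      ... | yes b∈ = b∈
      ... | no  b∉ = contradiction
        (Ycol-gapless 1≤j j≤k k≤λ₁ (nth∈ Yⱼ (≤-<-trans t≤i i<l)) b∉ (nth∈ Yₖ i'<l)
          (s≤s (nth-mono-≤ Yⱼ↑ t≤i i<l)) y<c) 1+y∉
      below : i < length Yₖ × nth Yₖ i ≤ nth Yⱼ i
      below = nth-subset-≤ Yⱼ↑ Yₖ↑ i i<l Yⱼ⊆Yₖ

-- The Demazure condition against membership in the principal ideal

theorem10p3 : (n : ℕ) → 1 ≤ n → (λ' : ℕ → ℕ) → IsPartition n λ' →
    (π : ℕ → ℕ) → IsLambdaPerm n λ' π → Avoids312 n λ' π →
    (T : Filling) → IsTableau n λ' T →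
    (scan n λ' T ≤[ n , λ' ] key n λ' π) ⇔ (T ≤[ n , λ' ] key n λ' π)
theorem10p3 n _ λ' _ π (perm , _) avoids T tableau = mk⇔ to from
  where
  open Scanning n λ' T tableau using (scan-entry; scan-strict)
  open Keys n π perm using (key-next)

  to : scan n λ' T ≤[ n , λ' ] key n λ' π → T ≤[ n , λ' ] key n λ' π
  to S≤Y j (suc i) box@(1≤j , j≤ , _ , i<ζ) =
    ≤-trans (proj₁ (scan-entry j 1≤j j≤ i<ζ)) (S≤Y j (suc i) box)

  from : T ≤[ n , λ' ] key n λ' π → scan n λ' T ≤[ n , λ' ] key n λ' π
  from T≤Y j (suc i) (1≤j , j≤ , _ , i<ζ) = go (ζ n λ' j) i (m≤n+m _ i) i<ζ
    where
    -- Induction from the bottom of column `j` upward; `d` bounds the number of rows from index `i`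
    -- on. The bottom row needs no case of its own: there `y<s` is absurd, since `key-next` would
    -- supply a row below it.
    go : ∀ d i → ζ n λ' j ≤ i + d → i < ζ n λ' j → scan n λ' T j (suc i) ≤ key n λ' π j (suc i)
    go zero    i ζ≤ i<ζ = contradiction (subst (ζ n λ' j ≤_) (+-identityʳ i) ζ≤) (<⇒≱ i<ζ)
    go (suc d) i ζ≤ i<ζ = ≮⇒≥ λ y<s →
      let _ , k , i' , j≤k , k≤ , i'≤i , i'<ζ , s≡ = scan-entry j 1≤j j≤ i<ζ
          s≤c = subst (_≤ key n λ' π k (suc i')) (sym s≡)
                  (T≤Y k (suc i') (≤-trans 1≤j j≤k , k≤ , s≤s z≤n , i'<ζ))
          1+i<ζ , next = key-next λ' avoids 1≤j j≤k k≤ i<ζ i'<ζ (s≤s⁻¹ i'≤i) (<-≤-trans y<s s≤c)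
          s<1+y = <-≤-trans (scan-strict j 1≤j j≤ 1+i<ζ)
                    (≤-trans (go d (suc i) (subst (ζ n λ' j ≤_) (+-suc i d) ζ≤) 1+i<ζ) next)
      in <⇒≱ y<s (s≤s⁻¹ s<1+y)
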